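{- The language $\mathcal{L}(\blacktriangle)$ is less expressive than the language $\mathcal{L}(\Box)$ on the class of serial models ($\mathcal{D}$-models).
   Context: Let $\mathbf{P}$ be a nonempty set of propositional variables. $\mathcal{L}(\blacktriangle)$-formulas: $\varphi::=\top\mid p\mid\neg\varphi\mid(\varphi\land\varphi)\mid\blacktriangle\varphi$ with $p\in\mathbf{P}$. $\mathcal{L}(\Box)$-formulas: the same with $\Box\varphi$ in place of $\blacktriangle\varphi$. A model is $\mathcal{M}=\langle S,R,V\rangle$ with $S$ a nonempty set, $R\subseteq S\times S$, $V:\mathbf{P}\to\mathcal{P}(S)$. It is serial if every $s\in S$ has some $t\in S$ with $sRt$. A pointed model is a pair $(\mathcal{M},s)$ with $s\in S$. Truth: $\top$, variables, $\neg,\land$ as usual; $\mathcal{M},s\vDash\Box\varphi$ iff $\mathcal{M},t\vDash\varphi$ for all $t$ with $sRt$; $\mathcal{M},s\vDash\blacktriangle\varphi$ iff (if $\mathcal{M},s\vDash\varphi$ then $\mathcal{M},t\vDash\varphi$ for all $t$ with $sRt$) and (if $\mathcal{M},s\nvDash\varphi$ then $\mathcal{M},t\nvDash\varphi$ for all $t$ with $sRt$). Expressivity on a class $\mathbb{M}$ of models: $\mathcal{L}_1\preceq\mathcal{L}_2$ if for every $\varphi\in\mathcal{L}_1$ there is $\psi\in\mathcal{L}_2$ such that for every pointed model $(\mathcal{M},s)$ with $\mathcal{M}\in\mathbb{M}$, $\mathcal{M},s\vDash\varphi$ iff $\mathcal{M},s\vDash\psi$. $\mathcal{L}_1$ is less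 expressive than $\mathcal{L}_2$ if $\mathcal{L}_1\preceq\mathcal{L}_2$ and $\mathcal{L}_2\not\preceq\mathcal{L}_1$. -}

module Defs where

open import Data.Product using (_×_; ∃-syntax)
open import Data.Unit.Polymorphic using () renaming (⊤ to True)
open import Function.Bundles using (_⇔_)
open import Level using (Level; _⊔_) renaming (suc to lsuc)
open import Relation.Binary.Core using (Rel)
open import Relation.Nullary.Negation using (¬_)
open import Relation.Unary using (Pred)

private
  variable
    a ℓ f g c : Level

record Model (P : Set a) (ℓ : Level) : Set (a ⊔ lsuc ℓ) where
  field
    S        : Set ℓ
    nonempty : S
    R        : Rel S ℓ
    V        : P → Pred S ℓ

Serial : {P : Set a} → Pred (Model P ℓ) ℓ
Serial M = ∀ s → ∃[ t ] R s t
  where open Model M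

infixr 6 _∧_

data Form▲ (P : Set a) : Set a where
  ⊤   : Form▲ P
  var : P → Form▲ P
  neg : Form▲ P → Form▲ P
  _∧_ : Form▲ P → Form▲ P → Form▲ P
  ▲_  : Form▲ P → Form▲ P

data Form□ (P : Set a) : Set a where
  ⊤   : Form□ P
  var : P → Form□ P
  neg : Form□ P → Form□ P
  _∧_ : Form□ P → Form□ P → Form□ P
  □_  : Form□ P → Form□ P

module _ {P : Set a} (M : Model P ℓ) where
  open Model M

  infix 4 _⊨▲_ _⊨□_

  _⊨▲_ : S → Form▲ P → Set ℓ
  s ⊨▲ ⊤       = True
  s ⊨▲ var p   = V p s
  s ⊨▲ neg φ   = ¬ (s ⊨▲ φ)
  s ⊨▲ (φ ∧ ψ) = (s ⊨▲ φ) × (s ⊨▲ ψ)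
  s ⊨▲ (▲ φ)   = (s ⊨▲ φ → ∀ t → R s t → t ⊨▲ φ)
               × (¬ (s ⊨▲ φ) → ∀ t → R s t → ¬ (t ⊨▲ φ))

  _⊨□_ : S → Form□ P → Set ℓ
  s ⊨□ ⊤       = True
  s ⊨□ var p   = V p s
  s ⊨□ neg φ   = ¬ (s ⊨□ φ)
  s ⊨□ (φ ∧ ψ) = (s ⊨□ φ) × (s ⊨□ ψ)
  s ⊨□ (□ φ)   = ∀ t → R s t → t ⊨□ φ

record Language (P : Set a) (ℓ f : Level) : Set (a ⊔ lsuc ℓ ⊔ lsuc f) where
  field
    Formula : Set f
    Sat     : (M : Model P ℓ) → Model.S M → Formula → Set ℓ

𝓛▲ : (P : Set a) (ℓ : Level) → Language P ℓ a
𝓛▲ P ℓ = record { Formula = Form▲ P ; Sat = _⊨▲_ }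

𝓛□ : (P : Set a) (ℓ : Level) → Language P ℓ a
𝓛□ P ℓ = record { Formula = Form□ P ; Sat = _⊨□_ }

module _ {P : Set a} (C : Pred (Model P ℓ) c) where
  open Language

  ExpressibleIn : Language P ℓ f → Language P ℓ g → Set (a ⊔ lsuc ℓ ⊔ c ⊔ f ⊔ g)
  ExpressibleIn L₁ L₂ =
    ∀ (φ : Formula L₁) → ∃[ ψ ]
      (∀ (M : Model P ℓ) → C M → ∀ s → Sat L₁ M s φ ⇔ Sat L₂ M s ψ)

  LessExpressive : Language P ℓ f → Language P ℓ g → Set (a ⊔ lsuc ℓ ⊔ c ⊔ f ⊔ g)
  LessExpressive L₁ L₂ = ExpressibleIn L₁ L₂ × ¬ ExpressibleIn L₂ L₁

{-# OPTIONS --safe #-}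
-- ▲φ is (φ → □φ) ∧ (¬φ → □¬φ).  Conversely, ▲ compares a state with its
-- successors, so it cannot see whether a state is its own successor, whereas □p
-- can: it fails once a loop is added to a ¬p-state all of whose successors satisfy p.

module Submission where

open import Defs
open import Axiom.DoubleNegationElimination using (em⇒dne)
open import Axiom.ExcludedMiddle using (ExcludedMiddle)
open import Data.Bool.Base using (Bool; true; false; T)
open import Data.Product using (_×_; _,_; proj₁; proj₂)
open import Data.Product.Function.NonDependent.Propositional using (_×-⇔_)
open import Function.Base using (id)
open import Function.Bundles using (_⇔_; mk⇔; Equivalence)
open import Function.Construct.Composition using (_⇔-∘_)
open import Function.Construct.Identity using (⇔-id)
open import Function.Related.TypeIsomorphisms using (→-cong-⇔; ¬-cong-⇔)
open import Level using (Level; Lift; lift; lower)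
open import Relation.Binary.Construct.Closure.Reflexive using (ReflClosure; refl; [_])
open import Relation.Nullary.Negation using (¬_)

open Equivalence using (to; from)

private
  variable
    a ℓ : Level
    P : Set a

infixr 5 _⇒_

_⇒_ : Form□ P → Form□ P → Form□ P
φ ⇒ ψ = neg (φ ∧ neg ψ)

-- The right-to-left direction recovers `ψ` from its double negation; this is where excluded middle
-- enters.
⊨□-⇒ : ExcludedMiddle ℓ → (M : Model P ℓ) → ∀ {s} φ ψ →
       ((_⊨□_ M s φ) → (_⊨□_ M s ψ)) ⇔ _⊨□_ M s (φ ⇒ ψ)
⊨□-⇒ em M φ ψ = mk⇔
  (λ f (x , ¬y) → ¬y (f x))
  (λ h x → em⇒dne em (λ ¬y → h (x , ¬y)))

▲-to-□ : Form▲ P → Form□ P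
▲-to-□ ⊤       = ⊤
▲-to-□ (var p) = var p
▲-to-□ (neg φ) = neg (▲-to-□ φ)
▲-to-□ (φ ∧ ψ) = ▲-to-□ φ ∧ ▲-to-□ ψ
▲-to-□ (▲ φ)   = (▲-to-□ φ ⇒ □ ▲-to-□ φ) ∧ (neg (▲-to-□ φ) ⇒ □ neg (▲-to-□ φ))

⊨-▲-to-□ : ExcludedMiddle ℓ → (M : Model P ℓ) → ∀ φ s →
           _⊨▲_ M s φ ⇔ _⊨□_ M s (▲-to-□ φ)
⊨-▲-to-□ em M ⊤       s = ⇔-id _
⊨-▲-to-□ em M (var p) s = ⇔-id _
⊨-▲-to-□ em M (neg φ) s = ¬-cong-⇔ (⊨-▲-to-□ em M φ s)
⊨-▲-to-□ em M (φ ∧ ψ) s = ⊨-▲-to-□ em M φ s ×-⇔ ⊨-▲-to-□ em M ψ s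
-- The lower factor acts first: it translates inside the two implications that define ▲. The upper
-- factor then turns these implications into formulas.
⊨-▲-to-□ em M (▲ φ)   s =
    (⊨□-⇒ em M φ′ (□ φ′) ×-⇔ ⊨□-⇒ em M (neg φ′) (□ neg φ′))
  ⇔-∘
    (→-cong-⇔ (ih s) (atSuccessors ih) ×-⇔ →-cong-⇔ (ih¬ s) (atSuccessors ih¬))
  where
  open Model M
  φ′ = ▲-to-□ φ
  ih = ⊨-▲-to-□ em M φ
  ih¬ = λ t → ¬-cong-⇔ (ih t)
  atSuccessors : {A B : S → Set _} → (∀ t → A t ⇔ B t) →
                 (∀ t → R s t → A t) ⇔ (∀ t → R s t → B t)
  atSuccessors A⇔B = mk⇔ (λ f t r → to (A⇔B t) (f t r)) (λ f t r → from (A⇔B t) (f t r))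

addLoops : Model P ℓ → Model P ℓ
addLoops M = record { S = S ; nonempty = nonempty ; R = ReflClosure R ; V = V }
  where open Model M

-- The edges added lead from a state to itself, and there the clause for ▲ only asks a state to
-- agree with itself.
⊨▲-addLoops : (M : Model P ℓ) → ∀ φ s → _⊨▲_ M s φ ⇔ _⊨▲_ (addLoops M) s φ
⊨▲-addLoops M ⊤       s = ⇔-id _
⊨▲-addLoops M (var p) s = ⇔-id _
⊨▲-addLoops M (neg φ) s = ¬-cong-⇔ (⊨▲-addLoops M φ s)
⊨▲-addLoops M (φ ∧ ψ) s = ⊨▲-addLoops M φ s ×-⇔ ⊨▲-addLoops M ψ s
-- The second half of the clause for ▲ is the first half with `neg φ` for `φ`.
⊨▲-addLoops M (▲ φ)   s = preserved φ ih ×-⇔ preserved (neg φ) (λ t → ¬-cong-⇔ (ih t))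
  where
  open Model M
  ih = ⊨▲-addLoops M φ
  preserved : ∀ χ → (∀ t → _⊨▲_ M t χ ⇔ _⊨▲_ (addLoops M) t χ) →
              (_⊨▲_ M s χ → ∀ t → R s t → _⊨▲_ M t χ) ⇔
              (_⊨▲_ (addLoops M) s χ → ∀ t → ReflClosure R s t → _⊨▲_ (addLoops M) t χ)
  preserved χ χ⇔ = mk⇔
    (λ { f x t [ r ] → to (χ⇔ t) (f (from (χ⇔ s) x) t r)
       -- On a new loop the premise is already the conclusion.
       ; f x t refl  → x })
    (λ f x t r → from (χ⇔ t) (f (to (χ⇔ s) x) t [ r ]))

-- Both states see exactly `true`, so `false` has a successor but no loop. The valuation ignores the
-- variable, so any `p` can serve to separate the languages.
intoTrue : Model P ℓ
intoTrue {ℓ = ℓ} = record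
  { S        = Lift ℓ Bool
  ; nonempty = lift true
  ; R        = λ _ t → Lift ℓ (T (lower t))
  ; V        = λ _ s → Lift ℓ (T (lower s))
  }

intoTrue-serial : Serial (intoTrue {P = P} {ℓ = ℓ})
intoTrue-serial _ = lift true , _

addLoops-serial : (M : Model P ℓ) → Serial (addLoops M)
addLoops-serial M s = s , refl

□-not-expressible : P → ¬ ExpressibleIn (Serial {ℓ = ℓ}) (𝓛□ P ℓ) (𝓛▲ P ℓ)
-- The added loop at `false` demands `p` there, that is, an element of `T false`.
□-not-expressible {P = P} {ℓ = ℓ} p expressible = lower (□p-with-loops (lift false) refl)
  where
  M : Model P ℓ
  M = intoTrue
  ψ = proj₁ (expressible (□ var p))
  □p⇔ψ = proj₂ (expressible (□ var p))
  □p-with-loops : _⊨□_ (addLoops M) (lift false) (□ var p)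
  □p-with-loops =
    from (□p⇔ψ (addLoops M) (addLoops-serial M) (lift false))
      (to (⊨▲-addLoops M ψ (lift false))
        -- In `M`, being a successor and satisfying `p` are the same type, hence `id`.
        (to (□p⇔ψ M (intoTrue-serial {P = P}) (lift false)) (λ _ → id)))

proposition11 : ∀ {a ℓ : Level} → ExcludedMiddle ℓ → (P : Set a) → P → LessExpressive {P = P} (Serial {ℓ = ℓ}) (𝓛▲ P ℓ) (𝓛□ P ℓ)
proposition11 em P p = (λ φ → ▲-to-□ φ , λ M _ → ⊨-▲-to-□ em M φ) , □-not-expressible p
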